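{- Let $G$ be a cubic graph. Then $G$ is 2FH if and only if $G$ admits a 3-malleable vertex.
   Context: Graphs are finite and connected, may have multiple (parallel) edges, and have no loops. The degree of a vertex is the number of edges incident to it; a cubic graph is a 3-regular graph. A $2$-factor of $G$ is a $2$-regular spanning subgraph (not necessarily connected; two parallel edges count as a $2$-regular component on two vertices), and a Hamiltonian cycle is a connected $2$-factor. A perfect matching is the edge set of a $1$-regular spanning subgraph. A Hamiltonian cycle $H$ extends a perfect matching $M$ if $M\subseteq E(H)$. A graph is 2FH (2-factor Hamiltonian) if it has a Hamiltonian cycle and each of its $2$-factors is a Hamiltonian cycle. For a vertex $v$, $\partial v$ denotes the set of edges incident to $v$. If $G$ admits a perfect matching and $v$ is a vertex of degree $t\ge 2$, then $v$ is $t$-malleable if for every perfect matching $M$ of $G$ there exist Hamiltonian cycles $H_1,\dots,H_{t-1}$ of $G$, all extending $M$, such that $\partial v - M\subset \bigcup_{i=1}^{t-1}E(H_i)$. (In particular, a graph with a $t$-malleable vertex admits a perfect matching.) -}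

module Defs where

open import Data.Fin.Base using (Fin)
open import Data.Fin.Properties using (_≟_)
open import Data.Fin.Subset using (Subset; _∈_; _⊆_; _∩_; _─_; ⋃; ⊤; ∣_∣)
open import Data.List.Base using (tabulate)
open import Data.Nat.Base using (ℕ; NonZero; _≤_; _∸_)
open import Data.Product.Base using (_×_; _,_; ∃-syntax; proj₁; proj₂)
open import Data.Sum.Base using (_⊎_)
import Data.Vec.Base as Vec
open import Relation.Binary.Construct.Closure.ReflexiveTransitive using (Star)
open import Relation.Binary.PropositionalEquality using (_≡_; _≢_)
open import Relation.Nullary.Decidable using (Dec; does; _⊎-dec_)

-- Finite loopless multigraphs.  Distinct edges may have the same ends, and the
-- order in which the two ends of an edge are listed is immaterial to every
-- notion below.  Connectedness is a separate predicate.
record Multigraph : Set where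
  field
    order    : ℕ
    size     : ℕ
    ends     : Fin size → Fin order × Fin order
    loopless : ∀ e → proj₁ (ends e) ≢ proj₂ (ends e)

  Vertex : Set
  Vertex = Fin order

  Edge : Set
  Edge = Fin size

  -- An edge set also stands for the spanning subgraph (all vertices, these
  -- edges); the graph itself is the edge set ⊤.
  EdgeSet : Set
  EdgeSet = Subset size

module _ (G : Multigraph) where
  open Multigraph G

  Incident : Vertex → Edge → Set
  Incident v e = v ≡ proj₁ (ends e) ⊎ v ≡ proj₂ (ends e)

  incident? : ∀ v e → Dec (Incident v e)
  incident? v e = (v ≟ proj₁ (ends e)) ⊎-dec (v ≟ proj₂ (ends e))

  ∂ : Vertex → EdgeSet
  ∂ v = Vec.tabulate λ e → does (incident? v e)

  degree : Vertex → ℕ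
  degree v = ∣ ∂ v ∣

  Cubic : Set
  Cubic = ∀ v → degree v ≡ 3

  RegularSpanning : ℕ → EdgeSet → Set
  RegularSpanning k F = ∀ v → ∣ ∂ v ∩ F ∣ ≡ k

  Adjacent : EdgeSet → Vertex → Vertex → Set
  Adjacent F u v = ∃[ e ] e ∈ F × (ends e ≡ (u , v) ⊎ ends e ≡ (v , u))

  -- The graph without vertices does not count as connected.
  ConnectedSpanning : EdgeSet → Set
  ConnectedSpanning F = NonZero order × (∀ u v → Star (Adjacent F) u v)

  Connected : Set
  Connected = ConnectedSpanning ⊤

  PerfectMatching : EdgeSet → Set
  PerfectMatching = RegularSpanning 1

  TwoFactor : EdgeSet → Set
  TwoFactor = RegularSpanning 2

  HamiltonianCycle : EdgeSet → Set
  HamiltonianCycle H = TwoFactor H × ConnectedSpanning H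

  TwoFactorHamiltonian : Set
  TwoFactorHamiltonian =
    (∃[ H ] HamiltonianCycle H) × (∀ F → TwoFactor F → HamiltonianCycle F)

  -- The Hamiltonian cycles H i need not be distinct.
  Malleable : ℕ → Vertex → Set
  Malleable t v =
    2 ≤ t × degree v ≡ t × (∃[ M ] PerfectMatching M) ×
    (∀ M → PerfectMatching M →
       ∃[ H ] (∀ (i : Fin (t ∸ 1)) → HamiltonianCycle (H i) × M ⊆ H i) ×
              (∂ v ─ M) ⊆ ⋃ (tabulate H))

{-# OPTIONS --safe #-}

-- (⇐) Let F be a 2-factor and M its complement.  Malleability gives a
-- Hamiltonian cycle H₁ ⊇ M; let B be the complement of H₁ and a the edge of
-- H₁ at v outside M.  Malleability at B gives a Hamiltonian cycle H ⊇ B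
-- containing a.  Then M and the complement of H are perfect matchings of the
-- cycle H₁ and both avoid a, so they coincide: H = F.
--
-- (⇒) Let M be a perfect matching, so that its complement C is a Hamiltonian
-- cycle.  Replace every edge of M by a walk in C with the same ends: the sum
-- modulo 2 of these walks is some N ⊆ C which has, like M, odd degree
-- everywhere, hence is a perfect matching.  This splits C into two perfect
-- matchings, whose complements are Hamiltonian cycles that extend M and
-- together contain every edge.
module Submission where

open import Defs
open import Data.Bool.Base using (Bool; true; false; not; _∨_; _xor_)
open import Data.Bool.Properties
  using (not-distribˡ-xor; not-distribʳ-xor; not-involutive; xor-assoc; xor-comm; xor-same)
open import Data.Fin.Base using (Fin; zero; suc)
open import Data.Fin.Properties using (_≟_)
open import Data.Fin.Subset
  using (Subset; inside; outside; _∈_; _∉_; _⊆_; _∩_; _-_; ∁; ⋃; ⊥; ⁅_⁆; ∣_∣; Nonempty)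
open import Data.Fin.Subset.Properties
open import Data.List.Base using (tabulate)
open import Data.Nat.Base using (ℕ; zero; suc; _+_; _≤_; s≤s; z≤n; NonZero)
open import Data.Nat.Properties using (+-suc; +-cancelˡ-≡; ≤-reflexive; ≤-trans)
open import Data.Product.Base using (_×_; _,_; ∃-syntax; proj₁; proj₂)
open import Data.Sum.Base using (inj₁; inj₂)
open import Data.Vec.Base using ([]; _∷_; lookup; zipWith; here; there)
open import Data.Vec.Properties using (lookup∘tabulate; lookup⇒[]=)
open import Function.Base using (_∘_)
open import Function.Bundles using (_⇔_; mk⇔)
open import Relation.Binary.Construct.Closure.ReflexiveTransitive using (Star; ε; _◅_)
import Relation.Binary.Construct.Closure.ReflexiveTransitive as Star
open import Relation.Binary.PropositionalEquality
  using (_≡_; refl; sym; trans; cong; cong₂; subst; module ≡-Reasoning)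
open import Relation.Nullary using (yes; no; does; contradiction)
open import Relation.Nullary.Decidable using (dec-true; decidable-stable)

open ≡-Reasoning

private
  variable
    n : ℕ
    p q : Subset n

-- Finite subsets

∣p∣≡1⇒Nonempty : ∣ p ∣ ≡ 1 → Nonempty p
∣p∣≡1⇒Nonempty {p = inside  ∷ p} _     = zero , here
∣p∣≡1⇒Nonempty {p = outside ∷ p} ∣p∣≡1
  with x , x∈p ← ∣p∣≡1⇒Nonempty {p = p} ∣p∣≡1 = suc x , there x∈p

∣p∣≡1⇒x≡y : ∀ {x y} → ∣ p ∣ ≡ 1 → x ∈ p → y ∈ p → x ≡ y
∣p∣≡1⇒x≡y {p = p} {x} {y} ∣p∣≡1 x∈p y∈p with x ≟ y
... | yes x≡y = x≡y
-- Removing `x` lowers the size but leaves `y` behind, so the chain of inequalities reads `2 ≤ 1`.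
... | no  x≢y = contradiction
  (≤-trans (s≤s (≤-trans (≤-reflexive (sym (∣⁅x⁆∣≡1 y))) (p⊆q⇒∣p∣≤∣q∣ ⁅y⁆⊆p-x)))
           (≤-trans (x∈p⇒∣p-x∣<∣p∣ x∈p) (≤-reflexive ∣p∣≡1)))
  λ { (s≤s ()) }
  where
  ⁅y⁆⊆p-x : ⁅ y ⁆ ⊆ p - x
  ⁅y⁆⊆p-x z∈⁅y⁆ = subst (_∈ p - x) (sym (x∈⁅y⁆⇒x≡y y z∈⁅y⁆)) (x∈p∧x≢y⇒x∈p-y y∈p (x≢y ∘ sym))

x∈⋃⁻ : ∀ {m x} (H : Fin m → Subset n) → x ∈ ⋃ (tabulate H) → ∃[ i ] x ∈ H i
x∈⋃⁻ {m = zero}  H x∈⊥ = contradiction x∈⊥ ∉⊥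
x∈⋃⁻ {m = suc m} H x∈⋃ with x∈p∪q⁻ (H zero) _ x∈⋃
... | inj₁ x∈H₀ = zero , x∈H₀
... | inj₂ x∈⋃′ with i , x∈Hᵢ ← x∈⋃⁻ (H ∘ suc) x∈⋃′ = suc i , x∈Hᵢ

∣p∩q∣+∣p∩∁q∣≡∣p∣ : ∀ (p q : Subset n) → ∣ p ∩ q ∣ + ∣ p ∩ ∁ q ∣ ≡ ∣ p ∣
∣p∩q∣+∣p∩∁q∣≡∣p∣ []            []            = refl
∣p∩q∣+∣p∩∁q∣≡∣p∣ (outside ∷ p) (_       ∷ q) = ∣p∩q∣+∣p∩∁q∣≡∣p∣ p q
∣p∩q∣+∣p∩∁q∣≡∣p∣ (inside  ∷ p) (inside  ∷ q) = cong suc (∣p∩q∣+∣p∩∁q∣≡∣p∣ p q)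
∣p∩q∣+∣p∩∁q∣≡∣p∣ (inside  ∷ p) (outside ∷ q) =
  trans (+-suc _ _) (cong suc (∣p∩q∣+∣p∩∁q∣≡∣p∣ p q))

p⊆q⇒q∩p≡p : p ⊆ q → q ∩ p ≡ p
p⊆q⇒q∩p≡p {p = p} {q = q} p⊆q =
  ⊆-antisym (p∩q⊆q q p) λ x∈p → x∈p∩q⁺ (p⊆q x∈p , x∈p)

-- Parity and sums modulo 2

odd : ℕ → Bool
odd zero    = false
odd (suc k) = not (odd k)

-- Serves to recognise perfect matchings: inside a 2-factor all degrees are at most 2, so it is
-- enough that they are odd.
odd∧≤2⇒≡1 : ∀ {k} → odd k ≡ true → k ≤ 2 → k ≡ 1
odd∧≤2⇒≡1 {suc zero}          _ _ = refl
odd∧≤2⇒≡1 {suc (suc (suc _))} _ (s≤s (s≤s ()))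

infixr 6 _⊕_

_⊕_ : Subset n → Subset n → Subset n
_⊕_ = zipWith _xor_

⊕-⊆ : ∀ {r : Subset n} → p ⊆ r → q ⊆ r → p ⊕ q ⊆ r
⊕-⊆ {p = inside  ∷ p} {outside ∷ q} p⊆r q⊆r here = p⊆r here
⊕-⊆ {p = outside ∷ p} {inside  ∷ q} p⊆r q⊆r here = q⊆r here
⊕-⊆ {p = _ ∷ p} {_ ∷ q} {r = _ ∷ r} p⊆r q⊆r (there x∈) =
  there (⊕-⊆ (drop-∷-⊆ p⊆r) (drop-∷-⊆ q⊆r) x∈)

⊥-⊕ : ∀ (p : Subset n) → ⊥ ⊕ p ≡ p
⊥-⊕ []      = refl
⊥-⊕ (x ∷ p) = cong (x ∷_) (⊥-⊕ p)

-- For fixed `r`, the parity of the intersection is a linear form over the two-element field: an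
-- element of both `p` and `q` flips the right-hand side twice.
odd-∩-⊕ : ∀ (r p q : Subset n) → odd ∣ r ∩ (p ⊕ q) ∣ ≡ odd ∣ r ∩ p ∣ xor odd ∣ r ∩ q ∣
odd-∩-⊕ []            []            []            = refl
odd-∩-⊕ (outside ∷ r) (_       ∷ p) (_       ∷ q) = odd-∩-⊕ r p q
odd-∩-⊕ (inside  ∷ r) (outside ∷ p) (outside ∷ q) = odd-∩-⊕ r p q
odd-∩-⊕ (inside  ∷ r) (inside  ∷ p) (outside ∷ q) =
  trans (cong not (odd-∩-⊕ r p q)) (not-distribˡ-xor (odd ∣ r ∩ p ∣) _)
odd-∩-⊕ (inside  ∷ r) (outside ∷ p) (inside  ∷ q) =
  trans (cong not (odd-∩-⊕ r p q)) (not-distribʳ-xor (odd ∣ r ∩ p ∣) _)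
odd-∩-⊕ (inside  ∷ r) (inside  ∷ p) (inside  ∷ q) = begin
  odd ∣ r ∩ (p ⊕ q) ∣                          ≡⟨ odd-∩-⊕ r p q ⟩
  odd ∣ r ∩ p ∣ xor odd ∣ r ∩ q ∣              ≡⟨ not-involutive _ ⟨
  not (not (odd ∣ r ∩ p ∣ xor odd ∣ r ∩ q ∣))  ≡⟨ cong not (not-distribˡ-xor (odd ∣ r ∩ p ∣) _) ⟩
  not (not (odd ∣ r ∩ p ∣) xor odd ∣ r ∩ q ∣)  ≡⟨ not-distribʳ-xor (not (odd ∣ r ∩ p ∣)) _ ⟩
  not (odd ∣ r ∩ p ∣) xor not (odd ∣ r ∩ q ∣)  ∎

odd-∩-⊥ : ∀ (p : Subset n) → odd ∣ p ∩ ⊥ ∣ ≡ false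
odd-∩-⊥ {n} p = cong odd (trans (cong ∣_∣ (∩-zeroʳ p)) (∣⊥∣≡0 n))

odd-∩-⁅⁆ : ∀ (p : Subset n) x → odd ∣ p ∩ ⁅ x ⁆ ∣ ≡ lookup p x
odd-∩-⁅⁆ (inside  ∷ p) zero    = cong not (odd-∩-⊥ p)
odd-∩-⁅⁆ (outside ∷ p) zero    = odd-∩-⊥ p
odd-∩-⁅⁆ (inside  ∷ p) (suc x) = odd-∩-⁅⁆ p x
odd-∩-⁅⁆ (outside ∷ p) (suc x) = odd-∩-⁅⁆ p x

-- The singletons span the vector space of subsets over the two-element field. This reduces claims
-- about edge sets to claims about single edges.
⊕-induction : ∀ {ℓ} (P : Subset n → Set ℓ) → P ⊥ → (∀ x → P ⁅ x ⁆) →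
  (∀ {p q} → P p → P q → P (p ⊕ q)) → ∀ p → P p
⊕-induction P P⊥ P⁅⁆ P⊕ []      = P⊥
⊕-induction P P⊥ P⁅⁆ P⊕ (b ∷ p) =
  prepend b (⊕-induction (P ∘ (outside ∷_)) P⊥ (P⁅⁆ ∘ suc) P⊕ p)
  where
  prepend : ∀ b → P (outside ∷ p) → P (b ∷ p)
  prepend outside Pp = Pp
  prepend inside  Pp = subst (P ∘ (inside ∷_)) (⊥-⊕ p) (P⊕ (P⁅⁆ zero) Pp)

xor-cancel-middle : ∀ x y z → (x xor y) xor (y xor z) ≡ x xor z
xor-cancel-middle x y z = begin
  (x xor y) xor (y xor z)  ≡⟨ xor-assoc x y (y xor z) ⟩
  x xor (y xor (y xor z))  ≡⟨ cong (x xor_) (xor-assoc y y z) ⟨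
  x xor ((y xor y) xor z)  ≡⟨ cong (λ b → x xor (b xor z)) (xor-same y) ⟩
  x xor z                  ∎

module _ (G : Multigraph) where
  open Multigraph G

  -- Regular spanning subgraphs

  regular-∁ : ∀ {k l F} → (∀ v → degree G v ≡ k + l) →
    RegularSpanning G k F → RegularSpanning G l (∁ F)
  regular-∁ {k} {l} {F} deg F-reg v = +-cancelˡ-≡ k _ _ (begin
    k + ∣ ∂ G v ∩ ∁ F ∣              ≡⟨ cong (_+ ∣ ∂ G v ∩ ∁ F ∣) (F-reg v) ⟨
    ∣ ∂ G v ∩ F ∣ + ∣ ∂ G v ∩ ∁ F ∣  ≡⟨ ∣p∩q∣+∣p∩∁q∣≡∣p∣ (∂ G v) F ⟩
    degree G v                       ≡⟨ deg v ⟩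
    k + l                            ∎)

  -- Degrees subtract because `F` lies in `C`. With `k` and `l` both 1 it turns one perfect matching
  -- of a 2-factor into the complementary one.
  regular-∩-∁ : ∀ {k l C F} → F ⊆ C → RegularSpanning G (k + l) C →
    RegularSpanning G k F → RegularSpanning G l (C ∩ ∁ F)
  regular-∩-∁ {k} {l} {C} {F} F⊆C C-reg F-reg v = +-cancelˡ-≡ k _ _ (begin
    k + ∣ ∂v ∩ (C ∩ ∁ F) ∣
      ≡⟨ cong (_+ ∣ ∂v ∩ (C ∩ ∁ F) ∣) (F-reg v) ⟨
    ∣ ∂v ∩ F ∣ + ∣ ∂v ∩ (C ∩ ∁ F) ∣
      ≡⟨ cong (λ S → ∣ ∂v ∩ S ∣ + ∣ ∂v ∩ (C ∩ ∁ F) ∣) (p⊆q⇒q∩p≡p F⊆C) ⟨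
    ∣ ∂v ∩ (C ∩ F) ∣ + ∣ ∂v ∩ (C ∩ ∁ F) ∣
      ≡⟨ cong₂ (λ S T → ∣ S ∣ + ∣ T ∣) (∩-assoc ∂v C F) (∩-assoc ∂v C (∁ F)) ⟨
    ∣ (∂v ∩ C) ∩ F ∣ + ∣ (∂v ∩ C) ∩ ∁ F ∣
      ≡⟨ ∣p∩q∣+∣p∩∁q∣≡∣p∣ (∂v ∩ C) F ⟩
    ∣ ∂v ∩ C ∣
      ≡⟨ C-reg v ⟩
    k + l
      ∎)
    where
    ∂v : EdgeSet
    ∂v = ∂ G v

  matching-edge-exists : ∀ {M} → PerfectMatching G M → ∀ v → ∃[ e ] e ∈ ∂ G v × e ∈ M
  matching-edge-exists M-pm v with e , e∈ ← ∣p∣≡1⇒Nonempty (M-pm v) = e , x∈p∩q⁻ (∂ G v) _ e∈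

  matching-edge-unique : ∀ {M e f} → PerfectMatching G M → ∀ v →
    e ∈ ∂ G v → f ∈ ∂ G v → e ∈ M → f ∈ M → e ≡ f
  matching-edge-unique M-pm v e∈∂v f∈∂v e∈M f∈M =
    ∣p∣≡1⇒x≡y (M-pm v) (x∈p∩q⁺ (e∈∂v , e∈M)) (x∈p∩q⁺ (f∈∂v , f∈M))

  Incident⇒∈∂ : ∀ {v e} → Incident G v e → e ∈ ∂ G v
  Incident⇒∈∂ {v} {e} v∈e =
    lookup⇒[]= e (∂ G v) (trans (lookup∘tabulate _ e) (dec-true (incident? G v e) v∈e))

  Adjacent⇒∈∂ : ∀ {F u w} ((e , _) : Adjacent G F u w) → e ∈ ∂ G u × e ∈ ∂ G w
  Adjacent⇒∈∂ (e , _ , inj₁ refl) = Incident⇒∈∂ (inj₁ refl) , Incident⇒∈∂ (inj₂ refl)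
  Adjacent⇒∈∂ (e , _ , inj₂ refl) = Incident⇒∈∂ (inj₂ refl) , Incident⇒∈∂ (inj₁ refl)

  -- Perfect matchings of a cycle

  PerfectMatchingOf : EdgeSet → EdgeSet → Set
  PerfectMatchingOf C M = M ⊆ C × PerfectMatching G M

  AgreeAt : EdgeSet → EdgeSet → Edge → Set
  AgreeAt M M′ e = (e ∈ M → e ∈ M′) × (e ∈ M′ → e ∈ M)

  module _ {C} (C-2f : TwoFactor G C) where

    -- At `v` the 2-factor `C` has one edge in the matching and one outside it, so the status of `e`
    -- decides that of `f`. If `e` is in neither matching and `f` were outside `M′`, both would lie
    -- in the perfect matching `C ∩ ∁ M′`, forcing `e ≡ f`.
    agree-at-vertex⇒∈ : ∀ {M M′ e f} → PerfectMatchingOf C M → PerfectMatchingOf C M′ → ∀ v →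
      e ∈ C → e ∈ ∂ G v → f ∈ ∂ G v → AgreeAt M M′ e → f ∈ M → f ∈ M′
    agree-at-vertex⇒∈ {M} {M′} {e} {f} (M⊆C , M-pm) (M′⊆C , M′-pm) v e∈C e∈∂v f∈∂v (to , from) f∈M
      with e ∈? M
    ... | yes e∈M = subst (_∈ M′) (matching-edge-unique M-pm v e∈∂v f∈∂v e∈M f∈M) (to e∈M)
    ... | no  e∉M = decidable-stable (f ∈? M′) λ f∉M′ →
      e∉M (subst (_∈ M) (sym (e≡f f∉M′)) f∈M)
      where
      e≡f : f ∉ M′ → e ≡ f
      e≡f f∉M′ = matching-edge-unique (regular-∩-∁ M′⊆C C-2f M′-pm) v e∈∂v f∈∂v
        (x∈p∩q⁺ (e∈C , x∉p⇒x∈∁p (e∉M ∘ from))) (x∈p∩q⁺ (M⊆C f∈M , x∉p⇒x∈∁p f∉M′))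

    module _ {M M′} (M-of : PerfectMatchingOf C M) (M′-of : PerfectMatchingOf C M′) where

      AgreeAround : Vertex → Set
      AgreeAround v = ∀ {e} → e ∈ ∂ G v → AgreeAt M M′ e

      agree-around : ∀ v {e} → e ∈ C → e ∈ ∂ G v → AgreeAt M M′ e → AgreeAround v
      agree-around v e∈C e∈∂v (to , from) f∈∂v =
        agree-at-vertex⇒∈ M-of M′-of v e∈C e∈∂v f∈∂v (to , from) ,
        agree-at-vertex⇒∈ M′-of M-of v e∈C e∈∂v f∈∂v (from , to)

      agree-along : ∀ {u w} → Star (Adjacent G C) u w → AgreeAround u → AgreeAround w
      agree-along ε                                 agree = agree
      agree-along (_◅_ {j = v} a@(e , e∈C , _) v⟶w) agree with e∈∂u , e∈∂v ← Adjacent⇒∈∂ a =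
        agree-along v⟶w (agree-around v e∈C e∈∂v (agree e∈∂u))

      -- Agreement at one edge spreads to all edges at its end, and from there along walks in `C` to
      -- the end of any other edge.
      agree-somewhere⇒⊆ : ConnectedSpanning G C → ∀ {e} → e ∈ C → AgreeAt M M′ e → M ⊆ M′
      agree-somewhere⇒⊆ (_ , walk) {e} e∈C agree {f} =
        proj₁ (agree-along (walk (proj₁ (ends e)) (proj₁ (ends f)))
          (agree-around (proj₁ (ends e)) e∈C (Incident⇒∈∂ (inj₁ refl)) agree)
          (Incident⇒∈∂ (inj₁ refl)))

  -- Sums of walks

  odd-∂-⁅⁆ : ∀ u e →
    odd ∣ ∂ G u ∩ ⁅ e ⁆ ∣ ≡ does (u ≟ proj₁ (ends e)) xor does (u ≟ proj₂ (ends e))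
  odd-∂-⁅⁆ u e = begin
    odd ∣ ∂ G u ∩ ⁅ e ⁆ ∣                                  ≡⟨ odd-∩-⁅⁆ (∂ G u) e ⟩
    lookup (∂ G u) e                                       ≡⟨ lookup∘tabulate _ e ⟩
    does (u ≟ proj₁ (ends e)) ∨ does (u ≟ proj₂ (ends e))  ≡⟨ ∨≡xor ⟩
    does (u ≟ proj₁ (ends e)) xor does (u ≟ proj₂ (ends e))  ∎
    where
    ∨≡xor : does (u ≟ proj₁ (ends e)) ∨ does (u ≟ proj₂ (ends e)) ≡
            does (u ≟ proj₁ (ends e)) xor does (u ≟ proj₂ (ends e))
    ∨≡xor with u ≟ proj₁ (ends e) | u ≟ proj₂ (ends e)
    -- The only case in which disjunction and exclusive or differ would be a loop.
    ... | yes u≡x | yes u≡y = contradiction (trans (sym u≡x) u≡y) (loopless e)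
    ... | yes _   | no  _   = refl
    ... | no  _   | _       = refl

  odd-∂-Adjacent : ∀ {F x y} ((e , _) : Adjacent G F x y) u →
    odd ∣ ∂ G u ∩ ⁅ e ⁆ ∣ ≡ does (u ≟ x) xor does (u ≟ y)
  odd-∂-Adjacent (e , _ , inj₁ refl) u = odd-∂-⁅⁆ u e
  odd-∂-Adjacent (e , _ , inj₂ refl) u = trans (odd-∂-⁅⁆ u e) (xor-comm (does (u ≟ proj₁ (ends e))) _)

  -- Each passage through an intermediate vertex contributes two edge ends, which cancel modulo 2,
  -- so only the two ends of the walk remain. An edge traversed an even number of times drops out of
  -- `N`.
  walk-sum : ∀ {C x y} → Star (Adjacent G C) x y →
    ∃[ N ] N ⊆ C × (∀ u → odd ∣ ∂ G u ∩ N ∣ ≡ does (u ≟ x) xor does (u ≟ y))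
  walk-sum {x = x} ε = ⊥ , (λ e∈⊥ → contradiction e∈⊥ ∉⊥) , λ u →
    trans (odd-∩-⊥ (∂ G u)) (sym (xor-same (does (u ≟ x))))
  walk-sum {C} {x} {z} (_◅_ {j = y} a@(e , e∈C , _) y⟶z) with N , N⊆C , odd-N ← walk-sum y⟶z =
    ⁅ e ⁆ ⊕ N ,
    ⊕-⊆ (λ f∈⁅e⁆ → subst (_∈ C) (sym (x∈⁅y⁆⇒x≡y e f∈⁅e⁆)) e∈C) N⊆C ,
    λ u → begin
      odd ∣ ∂ G u ∩ (⁅ e ⁆ ⊕ N) ∣
        ≡⟨ odd-∩-⊕ (∂ G u) ⁅ e ⁆ N ⟩
      odd ∣ ∂ G u ∩ ⁅ e ⁆ ∣ xor odd ∣ ∂ G u ∩ N ∣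
        ≡⟨ cong₂ _xor_ (odd-∂-Adjacent a u) (odd-N u) ⟩
      (does (u ≟ x) xor does (u ≟ y)) xor (does (u ≟ y) xor does (u ≟ z))
        ≡⟨ xor-cancel-middle (does (u ≟ x)) _ _ ⟩
      does (u ≟ x) xor does (u ≟ z)
        ∎

  -- Vertex parities are additive under `⊕`, so it suffices to replace a single edge by a walk in
  -- `C` between its ends.
  same-parity-within : ∀ {C} → ConnectedSpanning G C → ∀ F →
    ∃[ N ] N ⊆ C × (∀ u → odd ∣ ∂ G u ∩ N ∣ ≡ odd ∣ ∂ G u ∩ F ∣)
  same-parity-within {C} (_ , walk) = ⊕-induction
    (λ F → ∃[ N ] N ⊆ C × (∀ u → odd ∣ ∂ G u ∩ N ∣ ≡ odd ∣ ∂ G u ∩ F ∣))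
    (⊥ , (λ e∈⊥ → contradiction e∈⊥ ∉⊥) , λ _ → refl)
    (λ e → let N , N⊆C , odd-N = walk-sum (walk (proj₁ (ends e)) (proj₂ (ends e)))
           in N , N⊆C , λ u → trans (odd-N u) (sym (odd-∂-⁅⁆ u e)))
    λ {F} {F′} (N , N⊆C , odd-N) (N′ , N′⊆C , odd-N′) → N ⊕ N′ , ⊕-⊆ N⊆C N′⊆C , λ u →
      trans (odd-∩-⊕ (∂ G u) N N′)
        (trans (cong₂ _xor_ (odd-N u) (odd-N′ u)) (sym (odd-∩-⊕ (∂ G u) F F′)))

  -- The existence of M replaces the assumption that the cycle C is even.
  matching-of-cycle : ∀ {C M} → HamiltonianCycle G C → PerfectMatching G M →
    ∃[ N ] PerfectMatchingOf C N
  matching-of-cycle {C} {M} (C-2f , C-conn) M-pm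
    with N , N⊆C , odd-N ← same-parity-within C-conn M =
    N , N⊆C , λ u → odd∧≤2⇒≡1 (trans (odd-N u) (cong odd (M-pm u)))
      (≤-trans (p⊆q⇒∣p∣≤∣q∣ (∂u∩N⊆∂u∩C u)) (≤-reflexive (C-2f u)))
    where
    ∂u∩N⊆∂u∩C : ∀ u → ∂ G u ∩ N ⊆ ∂ G u ∩ C
    ∂u∩N⊆∂u∩C u e∈ with e∈∂u , e∈N ← x∈p∩q⁻ (∂ G u) N e∈ = x∈p∩q⁺ (e∈∂u , N⊆C e∈N)

  -- The two implications for cubic graphs

  module _ (cubic : Cubic G) where

    2FH⇒malleable : TwoFactorHamiltonian G → ∀ v → Malleable G 3 v
    2FH⇒malleable ((H₀ , H₀-2f , _) , 2f⇒ham) v =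
      s≤s (s≤s z≤n) , cubic v , (∁ H₀ , regular-∁ cubic H₀-2f) , cover
      where
      cover : ∀ M → PerfectMatching G M →
        ∃[ H ] (∀ (i : Fin 2) → HamiltonianCycle G (H i) × M ⊆ H i) × _ ⊆ ⋃ (tabulate H)
      cover M M-pm with N , N⊆C , N-pm ← matching-of-cycle (2f⇒ham _ (regular-∁ cubic M-pm)) M-pm =
        -- The two cycles cover every edge of the graph, in particular those at `v`.
        H , extends , λ {e} _ → every-edge e
        where
        -- The cycle `∁ M` splits into `N` and `N′`. Hence `∁ N` consists of `M` and `N′`, and
        -- `∁ N′` of `M` and `N`.
        N′ : EdgeSet
        N′ = ∁ M ∩ ∁ N

        H : Fin 2 → EdgeSet
        H zero       = ∁ N
        H (suc zero) = ∁ N′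

        extends : ∀ i → HamiltonianCycle G (H i) × M ⊆ H i
        extends zero =
          2f⇒ham _ (regular-∁ cubic N-pm) ,
          λ e∈M → x∉p⇒x∈∁p (x∈p⇒x∉∁p e∈M ∘ N⊆C)
        extends (suc zero) =
          2f⇒ham _ (regular-∁ cubic (regular-∩-∁ N⊆C (regular-∁ cubic M-pm) N-pm)) ,
          λ e∈M → x∉p⇒x∈∁p (x∈p⇒x∉∁p e∈M ∘ p∩q⊆p (∁ M) (∁ N))

        every-edge : ∀ e → e ∈ ⋃ (tabulate H)
        every-edge e with e ∈? N
        ... | no  e∉N = x∈p∪q⁺ (inj₁ (x∉p⇒x∈∁p e∉N))
        ... | yes e∈N = x∈p∪q⁺ (inj₂ (x∈p∪q⁺ (inj₁
          (x∉p⇒x∈∁p (x∈p⇒x∉∁p e∈N ∘ p∩q⊆q (∁ M) (∁ N))))))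

    malleable⇒2FH : ∀ v → Malleable G 3 v → TwoFactorHamiltonian G
    malleable⇒2FH v (_ , _ , (M₀ , M₀-pm) , cover)
      with H₀ , H₀-ext , _ ← cover M₀ M₀-pm =
      (H₀ zero , proj₁ (H₀-ext zero)) , 2f⇒ham
      where
      2f⇒ham : ∀ F → TwoFactor G F → HamiltonianCycle G F
      2f⇒ham F F-2f
        with H₁s , H₁-ext , _ ← cover (∁ F) (regular-∁ cubic F-2f)
        with (H₁-2f , H₁-conn) , M⊆H₁ ← H₁-ext zero
        with H₁ ← H₁s zero
        with a , a∈∂v , a∈H₁∖M ← matching-edge-exists (regular-∩-∁ M⊆H₁ H₁-2f (regular-∁ cubic F-2f)) v
        with a∈H₁ , a∈∁M ← x∈p∩q⁻ H₁ _ a∈H₁∖M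
        -- Now `∁ H₁` is the matching to be extended. As `a` lies in `H₁`, it is among the edges at
        -- `v` that the new cycles must cover.
        with Hs , H-ext , H-cover ← cover (∁ H₁) (regular-∁ cubic H₁-2f)
        with i , a∈H ← x∈⋃⁻ Hs (H-cover (x∈p∧x∉q⇒x∈p─q a∈∂v (x∈p⇒x∉∁p a∈H₁)))
        with (H-2f , nz , H-walk) , B⊆H ← H-ext i
        with H ← Hs i =
        -- Connectedness passes from `H` to `F` along the inclusion `H⊆F`.
        F-2f , nz , λ u w → Star.map (λ (e , e∈H , ends-e) → e , H⊆F e∈H , ends-e) (H-walk u w)
        where
        ∁H⊆H₁ : ∁ H ⊆ H₁
        ∁H⊆H₁ e∈∁H = x∉∁p⇒x∈p (x∈∁p⇒x∉p e∈∁H ∘ B⊆H)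

        H⊆F : H ⊆ F
        -- Both `∁ F` and `∁ H` are perfect matchings of the cycle `H₁`, and they agree at `a` since
        -- neither contains it.
        H⊆F = ∁p⊆∁q⇒p⊇q (agree-somewhere⇒⊆ H₁-2f
          (M⊆H₁ , regular-∁ cubic F-2f) (∁H⊆H₁ , regular-∁ cubic H-2f) H₁-conn a∈H₁
          ((λ a∈M → contradiction a∈M (x∈∁p⇒x∉p a∈∁M)) ,
           (λ a∈∁H → contradiction a∈H (x∈∁p⇒x∉p a∈∁H))))

theorem2p2 : ∀ (G : Multigraph) → Connected G → Cubic G →
    (TwoFactorHamiltonian G ⇔ (∃[ v ] Malleable G 3 v))
theorem2p2 G conn cubic = mk⇔
  -- Connectedness provides a vertex, and in a 2FH cubic graph any vertex is 3-malleable.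
  (λ 2fh → someVertex (proj₁ conn) , 2FH⇒malleable G cubic 2fh (someVertex (proj₁ conn)))
  (λ (v , malleable) → malleable⇒2FH G cubic v malleable)
  where
  someVertex : ∀ {k} → NonZero k → Fin k
  someVertex {suc _} _ = zero
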